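{- For every integer $n \geq 12$, $\mathcal{T}(n) \leq 1.09 \cdot \left(\frac{3}{2}\right)^n$.
   Context: A code $\mathcal{C} \subseteq \{0,1,2\}^n$ is called trifferent with length $n$ if for any three distinct elements of $\mathcal{C}$ there exists a coordinate in which they all differ. $\mathcal{T}(n)$ denotes the maximum cardinality of a trifferent code with length $n$. -}

module Defs where

open import Data.Nat using (ℕ)
open import Data.Fin using (Fin)
open import Data.Vec using (Vec; lookup)
open import Data.List using (List)
open import Data.List.Membership.Propositional using (_∈_)
open import Data.List.Relation.Unary.Unique.Propositional using (Unique)
open import Data.Product using (∃; _×_)
open import Relation.Binary.PropositionalEquality using (_≢_)

Word : ℕ → Set
Word n = Vec (Fin 3) n

-- A code C ⊆ {0,1,2}^n is represented as a duplicate-free list of words;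
-- its cardinality is the length of the list.
-- Trifferent: any three distinct elements of C all differ in some coordinate.
Trifferent : {n : ℕ} → List (Word n) → Set
Trifferent {n} C =
  ∀ {x y z} → x ∈ C → y ∈ C → z ∈ C →
  x ≢ y → y ≢ z → x ≢ z →
  ∃ λ (i : Fin n) →
    (lookup x i ≢ lookup y i) × (lookup y i ≢ lookup z i) × (lookup x i ≢ lookup z i)

record TrifferentCode (n : ℕ) : Set where
  field
    words      : List (Word n)
    distinct   : Unique words
    trifferent : Trifferent words

{-# OPTIONS --safe --termination-depth=2 #-}
module Submission where

-- In a trifferent code of length n + 1, the words with one of two given symbols in the first
-- coordinate form a trifferent code of length n after deleting that coordinate. Averaging over
-- the three pairs of symbols gives T(n+1) ≤ ⌊3 T(n) / 2⌋, so T(6) ≤ 13 yields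
-- T(7) ≤ 19, T(8) ≤ 28, T(9) ≤ 42, T(10) ≤ 63, T(11) ≤ 94, T(12) ≤ 141 ≤ 1.09 (3/2)^12,
-- and T(n+1) ≤ 3 T(n) / 2 does the rest.
--
-- That no code of length 6 has 14 words is proved by an exhaustive search which inverts the same
-- reduction. Call the least frequent symbol of the first coordinate 0 and let it occur k times.
-- Then a code with m words and length n + 1 arises from a code D with m − k words and length n,
-- where k ≤ m / 3, by distributing the symbols 1 and 2 over the words of D and adding k words that
-- start with 0. Starting from at most two words of length 0 this leaves very few codes at each
-- length, especially after identifying codes that differ by a permutation of the coordinates
-- or of the symbols in a coordinate.

open import Defs
open import Data.Nat using (ℕ; _≤_; _*_; _^_)
open import Data.List using (length)

open import Data.Bool using (Bool; true; false; if_then_else_; _∨_; T?)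
open import Data.Bool.ListAction using (all)
open import Data.Bool.Properties using () renaming (_≟_ to _≟ᵇ_)
open import Data.Empty using (⊥-elim)
open import Data.Fin using (Fin; zero; suc; toℕ; _≟_)
open import Data.Fin.Patterns using (0F; 1F; 2F)
open import Data.Fin.Properties using (all?)
open import Data.List using (List; []; _∷_; _++_; [_]; map; concat; concatMap; filterᵇ; replicate; deduplicate; upTo; take)
open import Data.List.Membership.Propositional using (_∈_; lose)
open import Data.List.Membership.Propositional.Properties using (∈-map⁺; ∈-++⁺ˡ; ∈-++⁺ʳ; ∈-++⁻; ∈-∃++; ∈-concatMap⁺; ∈-upTo⁺; ∈-deduplicate⁺)
open import Data.List.Properties using (map-++; map-∘; map-id; length-map; length-++; length-take; take++drop≡id; ++-conicalˡ; ++-conicalʳ) renaming (≡-dec to List-≡-dec)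
open import Data.List.Relation.Binary.Permutation.Propositional using (_↭_; ↭-refl; ↭-sym; ↭-trans; ↭-reflexive; prep; swap; ↭⇒↭ₛ)
open import Data.List.Relation.Binary.Permutation.Propositional.Properties using (map⁺; ++⁺; ++⁺ˡ; ++⁺ʳ; ++-comm; shift; drop-∷; ↭-empty-inv; ↭-map-inv; ↭-length; ∈-resp-↭; All-resp-↭; ++-identityʳ)
open import Data.List.Relation.Binary.Permutation.Setoid.Properties using (Unique-resp-↭)
open import Data.List.Relation.Binary.Subset.Propositional using (_⊆_)
open import Data.List.Relation.Unary.All using (All; []; _∷_)
import Data.List.Relation.Unary.All as All
import Data.List.Relation.Unary.All.Properties as All
open import Data.List.Relation.Unary.AllPairs using ([]; _∷_)
open import Data.List.Relation.Unary.Any using (here; there; any?)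
open import Data.Nat using (zero; suc; _+_; _∸_; _/_; _≤ᵇ_; _<ᵇ_; z≤n; s≤s)
open import Data.Nat.DivMod using (/-monoˡ-≤; m*n/n≡m)
open import Data.Nat.Properties using (≤-trans; ≤-total; ≤-reflexive; ≤⇒≤ᵇ; ≤ᵇ⇒≤; ≮⇒≥; *-identityˡ; n≤1+n; suc-injective; *-comm; +-mono-≤; +-monoʳ-≤; *-monoʳ-≤; m+n∸m≡n; m∸n+n≡m; m≤n⇒m⊓n≡m; module ≤-Reasoning)
open import Data.Nat.Tactic.RingSolver using (solve-∀)
open import Data.Product using (∃; _×_; _,_)
open import Data.Sum using (_⊎_; inj₁; inj₂)
open import Data.Vec using ([]; _∷_; head; tail; lookup)
open import Data.Vec.Properties using () renaming (≡-dec to Vec-≡-dec)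
open import Function using (_∘_; id)
open import Relation.Binary.PropositionalEquality using (_≡_; _≢_; refl; sym; trans; cong; cong₂; subst; subst₂; setoid)
open import Relation.Nullary using (¬_; Dec; does; yes; no; ¬?; from-yes)
open import Relation.Nullary.Decidable using (_→-dec_; _⊎-dec_; dec-true; dec-false)
open import Relation.Binary.Definitions using (DecidableEquality)

-- Symbols, and trifference as a Boolean test.

rainbow : Fin 3 → Fin 3 → Fin 3 → Bool
rainbow 0F 1F 2F = true
rainbow 0F 2F 1F = true
rainbow 1F 0F 2F = true
rainbow 1F 2F 0F = true
rainbow 2F 0F 1F = true
rainbow 2F 1F 0F = true
rainbow _  _  _  = false

trif : ∀ {n} → Word n → Word n → Word n → Bool
trif []      []      []      = false
trif (a ∷ x) (b ∷ y) (c ∷ z) = rainbow a b c ∨ trif x y z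

_≟ʷ_ : ∀ {n} → DecidableEquality (Word n)
_≟ʷ_ = Vec-≡-dec _≟_

_∈?_ : ∀ {n} (w : Word n) C → Dec (w ∈ C)
w ∈? C = any? (w ≟ʷ_) C

relabel : Fin 3 → Fin 3 → Fin 3 → Fin 3
relabel a b x = if does (x ≟ a) then 0F else if does (x ≟ b) then 1F else 2F

abstract
  rainbow-distinct : ∀ a b c → a ≢ b → b ≢ c → a ≢ c → rainbow a b c ≡ true
  rainbow-distinct = from-yes (all? λ a → all? λ b → all? λ c →
    ¬? (a ≟ b) →-dec (¬? (b ≟ c) →-dec (¬? (a ≟ c) →-dec (rainbow a b c ≟ᵇ true))))

  rainbow⇒≢₁₂ : ∀ a b c → rainbow a b c ≡ true → a ≢ b
  rainbow⇒≢₁₂ = from-yes (all? λ a → all? λ b → all? λ c →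
    (rainbow a b c ≟ᵇ true) →-dec ¬? (a ≟ b))

  rainbow-swap₂₃ : ∀ a b c → rainbow a b c ≡ true → rainbow a c b ≡ true
  rainbow-swap₂₃ = from-yes (all? λ a → all? λ b → all? λ c →
    (rainbow a b c ≟ᵇ true) →-dec (rainbow a c b ≟ᵇ true))

  rainbow-rotate : ∀ a b c → rainbow a b c ≡ true → rainbow b c a ≡ true
  rainbow-rotate = from-yes (all? λ a → all? λ b → all? λ c →
    (rainbow a b c ≟ᵇ true) →-dec (rainbow b c a ≟ᵇ true))

  rainbow-exhaustive : ∀ a b c x → rainbow a b c ≡ true → x ≡ a ⊎ x ≡ b ⊎ x ≡ c
  rainbow-exhaustive = from-yes (all? λ a → all? λ b → all? λ c → all? λ x →
    (rainbow a b c ≟ᵇ true) →-dec ((x ≟ a) ⊎-dec ((x ≟ b) ⊎-dec (x ≟ c))))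

  two-symbols⇒¬rainbow : ∀ s t a b c → a ≡ s ⊎ a ≡ t → b ≡ s ⊎ b ≡ t → c ≡ s ⊎ c ≡ t →
    rainbow a b c ≡ false
  two-symbols⇒¬rainbow = from-yes (all? λ s → all? λ t → all? λ a → all? λ b → all? λ c →
    ((a ≟ s) ⊎-dec (a ≟ t)) →-dec (((b ≟ s) ⊎-dec (b ≟ t)) →-dec
    (((c ≟ s) ⊎-dec (c ≟ t)) →-dec (rainbow a b c ≟ᵇ false))))

  relabel-rainbow : ∀ a b x y z → a ≢ b → rainbow x y z ≡ true →
    rainbow (relabel a b x) (relabel a b y) (relabel a b z) ≡ true
  relabel-rainbow = from-yes (all? λ a → all? λ b → all? λ x → all? λ y → all? λ z →
    ¬? (a ≟ b) →-dec ((rainbow x y z ≟ᵇ true) →-dec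
    (rainbow (relabel a b x) (relabel a b y) (relabel a b z) ≟ᵇ true)))

  relabel₁ : ∀ a b → relabel a b a ≡ 0F
  relabel₁ = from-yes (all? λ a → all? λ b → relabel a b a ≟ 0F)

  relabel₂ : ∀ a b c → rainbow a b c ≡ true → relabel a b b ≡ 1F
  relabel₂ = from-yes (all? λ a → all? λ b → all? λ c →
    (rainbow a b c ≟ᵇ true) →-dec (relabel a b b ≟ 1F))

  relabel₃ : ∀ a b c → rainbow a b c ≡ true → relabel a b c ≡ 2F
  relabel₃ = from-yes (all? λ a → all? λ b → all? λ c →
    (rainbow a b c ≟ᵇ true) →-dec (relabel a b c ≟ 2F))

trif-diag : ∀ {n} (x y : Word n) → trif x x y ≡ false
trif-diag []      []      = refl
trif-diag (a ∷ x) (b ∷ y)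
  rewrite two-symbols⇒¬rainbow a b a a b (inj₁ refl) (inj₁ refl) (inj₂ refl) = trif-diag x y

trif-lookup : ∀ {n} (x y z : Word n) i →
  lookup x i ≢ lookup y i → lookup y i ≢ lookup z i → lookup x i ≢ lookup z i → trif x y z ≡ true
trif-lookup (a ∷ x) (b ∷ y) (c ∷ z) zero p q r rewrite rainbow-distinct a b c p q r = refl
trif-lookup (a ∷ x) (b ∷ y) (c ∷ z) (suc i) p q r with rainbow a b c
... | true  = refl
... | false = trif-lookup x y z i p q r

-- Trifferent multisets of words and the maps that preserve them.

-- Quantifying over all ways to bring three positions to the front makes this a
-- property of multisets, and avoids carrying distinctness of the words around.
Tri : ∀ {n} → List (Word n) → Set
Tri C = ∀ {x y z R} → C ↭ x ∷ y ∷ z ∷ R → trif x y z ≡ true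

Tri-resp-↭ : ∀ {n} {C D : List (Word n)} → C ↭ D → Tri C → Tri D
Tri-resp-↭ C↭D t p = t (↭-trans C↭D p)

Tri-++ˡ : ∀ {n} {C D : List (Word n)} → Tri (C ++ D) → Tri C
Tri-++ˡ {D = D} t p = t (++⁺ʳ D p)

Tri-++ʳ : ∀ {n} (C : List (Word n)) {D} → Tri (C ++ D) → Tri D
Tri-++ʳ C {D} t = Tri-++ˡ (Tri-resp-↭ (++-comm C D) t)

code⇒Tri : ∀ {n} (C : TrifferentCode n) → Tri (TrifferentCode.words C)
code⇒Tri {n} C {x} {y} {z} p
  with Unique-resp-↭ (setoid (Word n)) (↭⇒↭ₛ p) (TrifferentCode.distinct C)
... | (x≢y ∷ x≢z ∷ _) ∷ (y≢z ∷ _) ∷ _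
  with TrifferentCode.trifferent C (back (here refl)) (back (there (here refl)))
         (back (there (there (here refl)))) x≢y y≢z x≢z
  where
  back : ∀ {w} → w ∈ _ → w ∈ TrifferentCode.words C
  back = ∈-resp-↭ (↭-sym p)
... | i , p₁ , p₂ , p₃ = trif-lookup x y z i p₁ p₂ p₃

Preserving : ∀ {n} → (Word n → Word n) → Set
Preserving f = ∀ x y z → trif x y z ≡ true → trif (f x) (f y) (f z) ≡ true

Tri-map : ∀ {n} {f : Word n → Word n} → Preserving f → ∀ {C} → Tri C → Tri (map f C)
Tri-map {f = f} pres t p with ↭-map-inv f p
... | _ ∷ _ ∷ _ ∷ _ , refl , q = pres _ _ _ (t q)

lift : ∀ {n} → (Fin 3 → Fin 3) → (Word n → Word n) → Word (suc n) → Word (suc n)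
lift g f (a ∷ w) = g a ∷ f w

lift-preserving : ∀ {n} {g : Fin 3 → Fin 3} {f : Word n → Word n} →
  (∀ a b c → rainbow a b c ≡ true → rainbow (g a) (g b) (g c) ≡ true) →
  Preserving f → Preserving (lift g f)
lift-preserving {g = g} pg pf (a ∷ x) (b ∷ y) (c ∷ z) t with rainbow a b c in eq
... | true rewrite pg a b c eq = refl
... | false with rainbow (g a) (g b) (g c)
...   | true  = refl
...   | false = pf x y z t

-- Splitting a code by the first symbol.

tails : ∀ {n} → Fin 3 → List (Word (suc n)) → List (Word n)
tails s []            = []
tails s ((a ∷ w) ∷ C) = if does (a ≟ s) then w ∷ tails s C else tails s C

block : ∀ {n} → Fin 3 → List (Word (suc n)) → List (Word (suc n))
block s C = map (s ∷_) (tails s C)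

block-hit : ∀ {n} s (w : Word n) C → block s ((s ∷ w) ∷ C) ≡ (s ∷ w) ∷ block s C
block-hit s w C rewrite dec-true (s ≟ s) refl = refl

block-miss : ∀ {n} {a s} (w : Word n) C → a ≢ s → block s ((a ∷ w) ∷ C) ≡ block s C
block-miss {a = a} {s} w C a≢s rewrite dec-false (a ≟ s) a≢s = refl

blocks : ∀ {n} {a b c} → rainbow a b c ≡ true → (C : List (Word (suc n))) →
  C ↭ block a C ++ block b C ++ block c C
blocks r [] = ↭-refl
blocks {a = a} {b} {c} r ((x ∷ w) ∷ C) with rainbow-exhaustive a b c x r
... | inj₁ refl
  rewrite block-hit a w C
        | block-miss {s = b} w C (rainbow⇒≢₁₂ a b c r)
        | block-miss {s = c} w C (rainbow⇒≢₁₂ a c b (rainbow-swap₂₃ a b c r))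
  = prep _ (blocks r C)
... | inj₂ (inj₁ refl)
  rewrite block-hit b w C
        | block-miss {s = a} w C (rainbow⇒≢₁₂ a b c r ∘ sym)
        | block-miss {s = c} w C (rainbow⇒≢₁₂ b c a (rainbow-rotate a b c r))
  = ↭-trans (prep _ (blocks r C)) (↭-sym (shift _ (block a C) _))
... | inj₂ (inj₂ refl)
  rewrite block-hit c w C
        | block-miss {s = a} w C (rainbow⇒≢₁₂ a c b (rainbow-swap₂₃ a b c r) ∘ sym)
        | block-miss {s = b} w C (rainbow⇒≢₁₂ b c a (rainbow-rotate a b c r) ∘ sym)
  = ↭-trans (prep _ (blocks r C)) (↭-trans (↭-sym (shift _ (block a C) _))
      (++⁺ˡ (block a C) (↭-sym (shift _ (block b C) _))))

length-blocks : ∀ {n} {a b c} → rainbow a b c ≡ true → (C : List (Word (suc n))) →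
  length C ≡ length (tails a C) + (length (tails b C) + length (tails c C))
length-blocks {a = a} {b} {c} r C = trans (↭-length (blocks r C))
  (trans (length-++ (block a C)) (cong₂ _+_ (length-map _ (tails a C))
    (trans (length-++ (block b C)) (cong₂ _+_ (length-map _ (tails b C)) (length-map _ (tails c C))))))

-- With only two symbols in the first coordinate, no triple is separated there, so a later
-- coordinate must do it.
puncture : ∀ {n} s t (P Q : List (Word n)) → Tri (map (s ∷_) P ++ map (t ∷_) Q) → Tri (P ++ Q)
puncture {n} s t P Q tri p
  -- `map tail` undoes the tagging, so a rearrangement of `P ++ Q` comes from one of the tagged
  -- words.
  with ↭-map-inv tail (↭-trans (↭-reflexive (untag P Q)) p)
  where
  untag : ∀ P Q → map tail (map (s ∷_) P ++ map (t ∷_) Q) ≡ P ++ Q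
  untag P Q = trans (map-++ tail (map (s ∷_) P) (map (t ∷_) Q))
    (cong₂ _++_ (trans (sym (map-∘ P)) (map-id P)) (trans (sym (map-∘ Q)) (map-id Q)))
... | (a ∷ x) ∷ (b ∷ y) ∷ (c ∷ z) ∷ _ , refl , q
  with All-resp-↭ q (All.++⁺ {P = λ w → head w ≡ s ⊎ head w ≡ t}
         (All.map⁺ (All.universal (λ _ → inj₁ refl) P)) (All.map⁺ (All.universal (λ _ → inj₂ refl) Q)))
... | ha ∷ hb ∷ hc ∷ _
  with tri q
... | r rewrite two-symbols⇒¬rainbow s t a b c ha hb hc = r

Tri-tails : ∀ {n} {a b c} → rainbow a b c ≡ true → {C : List (Word (suc n))} → Tri C →
  Tri (tails a C ++ tails b C)
Tri-tails {a = a} {b} {c} r {C} t = puncture a b (tails a C) (tails b C)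
  (Tri-++ʳ (block c C) (Tri-resp-↭ (blocks (rainbow-rotate b c a (rainbow-rotate a b c r)) C) t))

-- Words without repetition.

Distinct : ∀ {n} → List (Word n) → Set
Distinct C = ∀ {x R} → ¬ (C ↭ x ∷ x ∷ R)

-- A repeated `y` would give the triple `y`, `y`, `x`, which no coordinate separates. The companion
-- `x` matters: two equal words alone are vacuously `Tri`.
Tri⇒Distinct : ∀ {n} {x : Word n} {C} → Tri (x ∷ C) → Distinct C
Tri⇒Distinct {x = x} t {y} p
  with trans (sym (trif-diag y x)) (t (↭-trans (prep x p) (↭-trans (swap x y ↭-refl) (prep y (swap x y ↭-refl)))))
... | ()

Distinct-tail : ∀ {n} {x : Word n} {C D} → C ↭ x ∷ D → Distinct C → Distinct D
Distinct-tail {x = x} p d {y} q =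
  d (↭-trans p (↭-trans (prep x q) (↭-trans (swap x y ↭-refl) (prep y (swap x y ↭-refl)))))

extract : ∀ {n} {x : Word n} {C} → x ∈ C → ∃ λ D → C ↭ x ∷ D
extract {x = x} x∈C with ∈-∃++ x∈C
... | ys , zs , refl = ys ++ zs , shift x ys zs

⊆-uncons : ∀ {n} {x : Word n} {C D Z} → C ↭ x ∷ D → Distinct C → C ⊆ x ∷ Z → D ⊆ Z
⊆-uncons p d C⊆ a∈D with C⊆ (∈-resp-↭ (↭-sym p) (there a∈D)) | extract a∈D
... | here refl | _ , q = ⊥-elim (d (↭-trans p (prep _ q)))
... | there a∈Z | _     = a∈Z

⊆-drop : ∀ {n} {x : Word n} {C Z} → ¬ (x ∈ C) → C ⊆ x ∷ Z → C ⊆ Z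
⊆-drop x∉C C⊆ a∈C with C⊆ a∈C
... | here refl = ⊥-elim (x∉C a∈C)
... | there a∈Z = a∈Z

-- Pigeonhole; this is what makes the pruning in `split` safe.
Distinct-length : ∀ {n} (Z : List (Word n)) {C} → Distinct C → C ⊆ Z → length C ≤ length Z
Distinct-length []      {[]}    d C⊆ = z≤n
Distinct-length []      {x ∷ C} d C⊆ with C⊆ (here refl)
... | ()
Distinct-length (z ∷ Z) {C}     d C⊆ with z ∈? C
... | no  z∉C = ≤-trans (Distinct-length Z d (⊆-drop z∉C C⊆)) (n≤1+n _)
... | yes z∈C with extract z∈C
...   | D , p = ≤-trans (≤-reflexive (↭-length p)) (s≤s (Distinct-length Z (Distinct-tail p d) (⊆-uncons p d C⊆)))

-- Choosing the words that get the symbol 0.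

all-true : ∀ {n} (p : Word n → Bool) C → (∀ {x} → x ∈ C → p x ≡ true) → all p C ≡ true
all-true p []      h = refl
all-true p (x ∷ C) h rewrite h (here refl) = all-true p C (h ∘ there)

∈-filterᵇ : ∀ {n} (p : Word n → Bool) {x} C → x ∈ C → p x ≡ true → x ∈ filterᵇ p C
∈-filterᵇ p (y ∷ C) (here refl) px rewrite px = here refl
∈-filterᵇ p (y ∷ C) (there x∈C) px with p y
... | true  = there (∈-filterᵇ p C x∈C px)
... | false = ∈-filterᵇ p C x∈C px

-- X holds the words already in the code, including those chosen so far.
choose : ∀ {n} → ℕ → List (Word n) → List (Word n) → List (List (Word n))
choose zero    Z       X = [] ∷ []
choose (suc k) []      X = []
choose (suc k) (z ∷ Z) X =
  map (z ∷_) (choose k (filterᵇ (λ a → all (trif z a) X) Z) (z ∷ X)) ++ choose (suc k) Z X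

-- The filter discards nothing from `A`: `z`, another word of `A` and some `x` in `X` form a triple
-- of `x ∷ A`. Candidates are taken in the order of `Z`, so `A` is found only up to `↭`.
choose-complete : ∀ {n} k Z X {A : List (Word n)} → length A ≡ k → Distinct A → A ⊆ Z →
  Tri A → (∀ {x} → x ∈ X → Tri (x ∷ A)) → ∃ λ A′ → A′ ∈ choose k Z X × A′ ↭ A
choose-complete zero    Z       X {[]}    len d A⊆ t tX = [] , here refl , ↭-refl
choose-complete (suc k) []      X {a ∷ A} len d A⊆ t tX with A⊆ (here refl)
... | ()
choose-complete (suc k) (z ∷ Z) X {A}     len d A⊆ t tX with z ∈? A
... | no z∉A with choose-complete (suc k) Z X len d (⊆-drop z∉A A⊆) t tX
...   | A′ , A′∈ , p = A′ , ∈-++⁺ʳ _ A′∈ , p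
choose-complete (suc k) (z ∷ Z) X {A}     len d A⊆ t tX | yes z∈A with extract z∈A
... | D , p with choose-complete k (filterᵇ (λ a → all (trif z a) X) Z) (z ∷ X)
                   (suc-injective (trans (sym (↭-length p)) len)) (Distinct-tail p d) D⊆
                   (Tri-++ʳ [ z ] (Tri-resp-↭ p t)) tX′
  where
  D⊆ : D ⊆ filterᵇ (λ a → all (trif z a) X) Z
  D⊆ {a} a∈D with extract a∈D
  ... | _ , q = ∈-filterᵇ _ Z (⊆-uncons p d A⊆ a∈D) (all-true (trif z a) X λ {x} x∈X →
    tX x∈X (↭-trans (prep x (↭-trans p (prep z q))) (↭-trans (swap x z ↭-refl) (prep z (swap x a ↭-refl)))))

  tX′ : ∀ {x} → x ∈ z ∷ X → Tri (x ∷ D)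
  tX′ (here refl) = Tri-resp-↭ p t
  tX′ {x} (there x∈X) = Tri-++ʳ [ z ] (Tri-resp-↭ (↭-trans (prep x p) (swap x z ↭-refl)) (tX x∈X))
...   | D′ , D′∈ , q = z ∷ D′ , ∈-++⁺ˡ (∈-map⁺ (z ∷_) D′∈) , ↭-trans (prep z q) (↭-sym p)

-- Distributing the symbols 1 and 2 over a shorter code.

code : ∀ {n} → List (Word n) → List (Word n) → List (Word n) → List (Word (suc n))
code B C A = map (1F ∷_) B ++ map (2F ∷_) C ++ map (0F ∷_) A

code-↭ : ∀ {n} {B B′ C C′ A A′ : List (Word n)} → B ↭ B′ → C ↭ C′ → A ↭ A′ → code B C A ↭ code B′ C′ A′
code-↭ p q r = ++⁺ (map⁺ _ p) (++⁺ (map⁺ _ q) (map⁺ _ r))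

-- Two words sharing the symbol 1 (or 2) and one with the symbol 0 are not separated by the first
-- coordinate, so their tails must be. One word of each symbol is always separated.
compatible : ∀ {n} → Word n → List (Word n) → List (Word n) → List (Word n)
compatible d B Z = filterᵇ (λ z → all (λ y → trif d y z) B) Z

-- B and C are the words already given the symbols 1 and 2, D the words still to be placed,
-- and Z the words that may still be given the symbol 0, of which k are wanted.
split : ∀ {n} → ℕ → List (Word n) → List (Word n) → List (Word n) → List (Word n) →
  List (List (Word (suc n)))
split k []      B C Z = map (code B C) (choose k Z (B ++ C))
split k (d ∷ D) B C Z = if k ≤ᵇ length Z
  then split k D (d ∷ B) C (compatible d B Z) ++ split k D B (d ∷ C) (compatible d C Z)
  else []

compatible-⊆ : ∀ {n} {d : Word n} {B A Z} P → Tri ((P ++ d ∷ B) ++ A) → A ⊆ Z → A ⊆ compatible d B Z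
compatible-⊆ {d = d} {B} {A} {Z} P t A⊆ {a} a∈A =
  ∈-filterᵇ _ Z (A⊆ a∈A) (all-true (λ y → trif d y a) B sep)
  where
  sep : ∀ {y} → y ∈ B → trif d y a ≡ true
  sep {y} y∈B with extract (∈-++⁺ʳ P y∈B) | extract a∈A
  ... | M , p | N , q = t (↭-trans (++⁺ (↭-trans (shift d P B) (prep d p)) q)
                             (prep d (prep y (shift a M N))))

Tri-∷ : ∀ {n} {x : Word n} {B A} → x ∈ B → Tri (B ++ A) → Tri (x ∷ A)
Tri-∷ {x = x} {A = A} x∈B t with extract x∈B
... | B′ , p = Tri-++ˡ (Tri-resp-↭ (↭-trans (++⁺ʳ A p) (prep x (++-comm B′ A))) t)

move : ∀ {n} {x : Word n} {P P′ B} → P ↭ x ∷ P′ → P ++ B ↭ P′ ++ x ∷ B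
move {x = x} {P′ = P′} {B} p = ↭-trans (++⁺ʳ B p) (↭-sym (shift x P′ B))

-- `P` and `Q` record which of the words still in `D` get the symbols 1 and 2 in the code sought;
-- the search follows the branch that they dictate.
split-complete : ∀ {n} (D : List (Word n)) {B C Z A} P Q → D ↭ P ++ Q →
  Tri ((P ++ B) ++ A) → Tri ((Q ++ C) ++ A) → Distinct A → A ⊆ Z →
  ∃ λ E → E ∈ split (length A) D B C Z × E ↭ code (P ++ B) (Q ++ C) A
split-complete [] {B} {C} {Z} {A} P Q p tB tC d A⊆
  with refl ← ++-conicalˡ P Q (↭-empty-inv (↭-sym p))
  with refl ← ++-conicalʳ [] Q (↭-empty-inv (↭-sym p))
  with choose-complete (length A) Z (B ++ C) refl d A⊆ (Tri-++ʳ B tB) tX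
  where
  tX : ∀ {x} → x ∈ B ++ C → Tri (x ∷ A)
  tX x∈ with ∈-++⁻ B x∈
  ... | inj₁ x∈B = Tri-∷ x∈B tB
  ... | inj₂ x∈C = Tri-∷ x∈C tC
... | A′ , A′∈ , q = code B C A′ , ∈-map⁺ (code B C) A′∈ , code-↭ {B = B} ↭-refl ↭-refl q
split-complete (x ∷ D) {B} {C} {Z} {A} P Q p tB tC d A⊆
  -- The pruning test succeeds, since `Z` still contains the repetition-free `A`.
  rewrite dec-true (T? (length A ≤ᵇ length Z)) (≤⇒≤ᵇ (Distinct-length Z d A⊆))
  with ∈-++⁻ P (∈-resp-↭ p (here refl))
... | inj₁ x∈P with extract x∈P
...   | P′ , q with move {B = B} q
...     | moved with split-complete D {x ∷ B} {C} {compatible x B Z} P′ Q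
                       (drop-∷ (↭-trans p (++⁺ʳ Q q))) (Tri-resp-↭ (++⁺ʳ A moved) tB) tC d
                       (compatible-⊆ P′ (Tri-resp-↭ (++⁺ʳ A moved) tB) A⊆)
...       | E , E∈ , r = E , ∈-++⁺ˡ E∈ , ↭-trans r (code-↭ (↭-sym moved) (↭-refl {x = Q ++ C}) ↭-refl)
split-complete (x ∷ D) {B} {C} {Z} {A} P Q p tB tC d A⊆ | inj₂ x∈Q with extract x∈Q
...   | Q′ , q with move {B = C} q
...     | moved with split-complete D {B} {x ∷ C} {compatible x C Z} P Q′
                       (drop-∷ (↭-trans p (↭-trans (++⁺ˡ P q) (shift x P Q′)))) tB
                       (Tri-resp-↭ (++⁺ʳ A moved) tC) d
                       (compatible-⊆ Q′ (Tri-resp-↭ (++⁺ʳ A moved) tC) A⊆)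
...       | E , E∈ , r = E , ∈-++⁺ʳ _ E∈ , ↭-trans r (code-↭ (↭-refl {x = P ++ B}) (↭-sym moved) ↭-refl)

words : ∀ n → List (Word n)
words zero    = [] ∷ []
words (suc n) = map (0F ∷_) (words n) ++ map (1F ∷_) (words n) ++ map (2F ∷_) (words n)

∈-words : ∀ {n} (w : Word n) → w ∈ words n
∈-words []                 = here refl
∈-words {suc n} (0F ∷ w) = ∈-++⁺ˡ (∈-map⁺ _ (∈-words w))
∈-words {suc n} (1F ∷ w) = ∈-++⁺ʳ (map (0F ∷_) (words n)) (∈-++⁺ˡ (∈-map⁺ _ (∈-words w)))
∈-words {suc n} (2F ∷ w) =
  ∈-++⁺ʳ (map (0F ∷_) (words n)) (∈-++⁺ʳ (map (1F ∷_) (words n)) (∈-map⁺ _ (∈-words w)))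

-- Exchanging the symbols 1 and 2 if necessary, the first word is given the symbol 1.
extend : ∀ {n} → ℕ → List (Word n) → List (List (Word (suc n)))
extend     k []      = []
extend {n} k (d ∷ D) = split k D [ d ] [] (words n)

extend-complete : ∀ {n} {d : Word n} {D B C A} → d ∷ D ↭ B ++ C → d ∈ B →
  Tri (B ++ A) → Tri (C ++ A) → ∃ λ E → E ∈ extend (length A) (d ∷ D) × E ↭ code B C A
extend-complete {n} {d} {D} {B} {C} {A} p d∈B tB tC with extract d∈B
... | B′ , q with split-complete D {[ d ]} {[]} {words n} {A} B′ C (drop-∷ (↭-trans p (++⁺ʳ C q)))
                    (Tri-resp-↭ (++⁺ʳ A front) tB)
                    (Tri-resp-↭ (++⁺ʳ A (↭-sym (++-identityʳ C))) tC)
                    (Tri⇒Distinct (Tri-∷ d∈B tB)) (λ {w} _ → ∈-words w)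
  where
  front : B ↭ B′ ++ [ d ]
  front = ↭-trans q (++-comm [ d ] B′)
...   | E , E∈ , r = E , E∈ , ↭-trans r (code-↭ (↭-trans (++-comm B′ [ d ]) (↭-sym q)) (++-identityʳ C) ↭-refl)

-- Equivalence of codes and normalisation.

exchange : ∀ {n} → Word (suc (suc n)) → Word (suc (suc n))
exchange (a ∷ b ∷ w) = b ∷ a ∷ w

exchange-preserving : ∀ {n} → Preserving (exchange {n})
exchange-preserving (a ∷ a′ ∷ x) (b ∷ b′ ∷ y) (c ∷ c′ ∷ z) t with rainbow a b c | rainbow a′ b′ c′
... | true  | true  = refl
... | true  | false = refl
... | false | true  = refl
... | false | false = t

-- In order, these swap 0 with 2, 1 with 2, and 0 with 1 in the first coordinate.
transpositions : ∀ n → List (Word (suc n) → Word (suc n))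
transpositions n = lift (relabel 2F 1F) id ∷ lift (relabel 0F 2F) id ∷ lift (relabel 1F 0F) id ∷ []

generators : ∀ n → List (Word n → Word n)
generators 0             = []
generators 1             = transpositions 0
generators (suc (suc n)) =
  map (lift id) (generators (suc n)) ++ transpositions (suc n) ++ [ exchange ]

transpositions-preserving : ∀ n → All Preserving (transpositions n)
transpositions-preserving n = transposes 2F 1F (λ ()) ∷ transposes 0F 2F (λ ()) ∷ transposes 1F 0F (λ ()) ∷ []
  where
  transposes : ∀ a b → a ≢ b → Preserving {suc n} (lift (relabel a b) id)
  transposes a b a≢b = lift-preserving (λ x y z → relabel-rainbow a b x y z a≢b) (λ _ _ _ → id)

generators-preserving : ∀ n → All Preserving (generators n)
generators-preserving 0             = []
generators-preserving 1             = transpositions-preserving 0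
generators-preserving (suc (suc n)) =
  All.++⁺ (All.map⁺ (All.map (lift-preserving (λ _ _ _ → id)) (generators-preserving (suc n))))
    (All.++⁺ (transpositions-preserving (suc n)) (exchange-preserving ∷ []))

weight : ∀ {n} → Word n → ℕ
weight []      = 0
weight (a ∷ w) = toℕ a + weight w

square cube : ℕ → ℕ
square m = m * m
cube   m = m * m * m

-- bit w is 2 ^ (w read in base 3), so the bits of a code add up to its characteristic bit mask.
bit : ∀ {n} → Word n → ℕ
bit []       = 1
bit (0F ∷ w) = cube (bit w)
bit (1F ∷ w) = 2 * cube (bit w)
bit (2F ∷ w) = 4 * cube (bit w)

-- The factor is 2 ^ 256, which for n ≤ 5 exceeds the sum of all bits, so that weights are
-- compared first. It is the second factor because a literal first factor would be unrolled
-- when w is a variable.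
rank : ∀ {n} → Word n → ℕ
rank w = weight w * square (square (square (square (square (square (square (square 2))))))) + bit w

cost : ∀ {n} → List (Word n) → ℕ
cost []      = 0
cost (w ∷ C) = rank w + cost C

cheaper : ∀ {n} → List (Word n) → List (Word n) → List (Word n)
cheaper C D = if cost D <ᵇ cost C then D else C

descend : ∀ {n} → List (Word n → Word n) → List (Word n) → List (Word n)
descend []       C = C
descend (g ∷ gs) C = descend gs (cheaper C (map g C))

insert : ∀ {n} → Word n → List (Word n) → List (Word n)
insert w []      = [ w ]
insert w (v ∷ C) = if rank w <ᵇ rank v then w ∷ v ∷ C else v ∷ insert w C

-- Lists of the same words in different orders should coincide before `deduplicate` compares them.
sort : ∀ {n} → List (Word n) → List (Word n)
sort []      = []
sort (w ∷ C) = insert w (sort C)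

-- Not a canonical form: three greedy passes merely make most equivalent codes equal.
normalise : ∀ {n} → List (Word n) → List (Word n)
normalise {n} C = sort (descend (concat (replicate 3 (generators n))) C)

insert-↭ : ∀ {n} (w : Word n) C → insert w C ↭ w ∷ C
insert-↭ w []      = ↭-refl
insert-↭ w (v ∷ C) with rank w <ᵇ rank v
... | true  = ↭-refl
... | false = ↭-trans (prep v (insert-↭ w C)) (swap v w ↭-refl)

sort-↭ : ∀ {n} (C : List (Word n)) → sort C ↭ C
sort-↭ []      = ↭-refl
sort-↭ (w ∷ C) = ↭-trans (insert-↭ w (sort C)) (prep w (sort-↭ C))

-- One direction is enough: the search only has to contain some image of each trifferent code, and
-- images keep length and trifference.
_≼_ : ∀ {n} → List (Word n) → List (Word n) → Set
D ≼ C = ∃ λ f → Preserving f × D ↭ map f C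

≼-refl : ∀ {n} {C : List (Word n)} → C ≼ C
≼-refl {C = C} = id , (λ _ _ _ → id) , ↭-reflexive (sym (map-id C))

≼-trans : ∀ {n} {C D E : List (Word n)} → E ≼ D → D ≼ C → E ≼ C
≼-trans {C = C} (f , pf , p) (g , pg , q) =
  f ∘ g , (λ x y z t → pf _ _ _ (pg x y z t)) , ↭-trans p (↭-trans (map⁺ f q) (↭-reflexive (sym (map-∘ C))))

descend-≼ : ∀ {n} {gs : List (Word n → Word n)} → All Preserving gs → ∀ C → descend gs C ≼ C
descend-≼ []                      C = ≼-refl
descend-≼ {gs = g ∷ _} (pg ∷ pgs) C = ≼-trans (descend-≼ pgs (cheaper C (map g C))) cheaper-≼
  where
  cheaper-≼ : cheaper C (map g C) ≼ C
  cheaper-≼ with cost (map g C) <ᵇ cost C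
  ... | true  = g , pg , ↭-refl
  ... | false = ≼-refl

normalise-≼ : ∀ {n} (C : List (Word n)) → normalise C ≼ C
normalise-≼ {n} C with descend-≼ (All.concat⁺ (All.replicate⁺ 3 (generators-preserving n))) C
... | f , pf , p = f , pf , ↭-trans (sort-↭ _) p

-- The exhaustive search and its completeness.

reduce : ∀ {n} → List (List (Word n)) → List (List (Word n))
reduce L = deduplicate (List-≡-dec _≟ʷ_) (map normalise L)

∈-reduce : ∀ {n} {C : List (Word n)} {L} → C ∈ L → normalise C ∈ reduce L
∈-reduce C∈L = ∈-deduplicate⁺ (List-≡-dec _≟ʷ_) (∈-map⁺ normalise C∈L)

-- k is the number of words with the least frequent symbol in the first coordinate.
representatives : ∀ n → ℕ → List (List (Word n))
representatives zero    m = if m ≤ᵇ 2 then [ replicate m [] ] else []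
representatives (suc n) m =
  reduce (concatMap (λ k → concatMap (extend k) (representatives n (m ∸ k))) (upTo (suc (m / 3))))

least-symbol : (f : Fin 3 → ℕ) → ∃ λ a → ∃ λ b → ∃ λ c → rainbow a b c ≡ true × f a ≤ f b × f a ≤ f c
least-symbol f with ≤-total (f 0F) (f 1F)
... | inj₁ 0≤1 with ≤-total (f 0F) (f 2F)
...   | inj₁ 0≤2 = 0F , 1F , 2F , refl , 0≤1 , 0≤2
...   | inj₂ 2≤0 = 2F , 0F , 1F , refl , 2≤0 , ≤-trans 2≤0 0≤1
least-symbol f | inj₂ 1≤0 with ≤-total (f 1F) (f 2F)
...   | inj₁ 1≤2 = 1F , 0F , 2F , refl , 1≤0 , 1≤2
...   | inj₂ 2≤1 = 2F , 0F , 1F , refl , ≤-trans 2≤1 1≤0 , 2≤1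

least-third : ∀ {k p q m} → k ≤ p → k ≤ q → m ≡ k + (p + q) → k ≤ m / 3
least-third {k} {p} {q} {m} k≤p k≤q eq = begin
  k         ≡⟨ m*n/n≡m k 3 ⟨
  k * 3 / 3 ≤⟨ /-monoˡ-≤ 3 (≤-trans (≤-reflexive (thrice k)) (≤-trans (+-monoʳ-≤ k (+-mono-≤ k≤p k≤q)) (≤-reflexive (sym eq)))) ⟩
  m / 3     ∎
  where
  open ≤-Reasoning
  thrice : ∀ k → k * 3 ≡ k + (k + k)
  thrice = solve-∀

words₀ : (C : List (Word 0)) → C ≡ replicate (length C) []
words₀ []       = refl
words₀ ([] ∷ C) = cong ([] ∷_) (words₀ C)

module _ {n} {C : List (Word (suc n))} (t : Tri C) {f : Word n → Word n} (pf : Preserving f) where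

  -- Relabelling the first symbol and applying `f` to the tail is a single preserving map, so the
  -- map that normalises the shorter code extends to all of `C`.
  code-≼ : ∀ {a b c} → rainbow a b c ≡ true →
    code (map f (tails b C)) (map f (tails c C)) (map f (tails a C)) ≼ C
  code-≼ {a} {b} {c} r =
    lift (relabel a b) f ,
    lift-preserving (λ x y z → relabel-rainbow a b x y z (rainbow⇒≢₁₂ a b c r)) pf ,
    ↭-sym (↭-trans (map⁺ F (blocks (rainbow-rotate a b c r) C)) (↭-reflexive (trans (map-++ F (block b C) _)
      (cong₂ _++_ (relabelled (relabel₂ a b c r)) (trans (map-++ F (block c C) _)
        (cong₂ _++_ (relabelled (relabel₃ a b c r)) (relabelled (relabel₁ a b))))))))
    where
    F : Word (suc n) → Word (suc n)
    F = lift (relabel a b) f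
    relabelled : ∀ {s s′} → relabel a b s ≡ s′ → map F (block s C) ≡ map (s′ ∷_) (map f (tails s C))
    relabelled {s} refl = trans (sym (map-∘ (tails s C))) (map-∘ (tails s C))

  Tri-relabelled : ∀ {a b c} → rainbow a b c ≡ true → Tri (map f (tails a C) ++ map f (tails b C))
  Tri-relabelled {a} {b} r =
    Tri-resp-↭ (↭-reflexive (map-++ f (tails a C) (tails b C))) (Tri-map pf (Tri-tails r t))

  extend-≼ : ∀ {a b c d D} → rainbow a b c ≡ true → d ∷ D ↭ map f (tails b C) ++ map f (tails c C) →
    d ∈ map f (tails b C) → ∃ λ E → E ∈ extend (length (tails a C)) (d ∷ D) × E ≼ C
  extend-≼ {a} {b} {c} {d} {D} r p d∈
    with extend-complete {A = map f (tails a C)} p d∈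
           (Tri-relabelled (rainbow-swap₂₃ b c a (rainbow-rotate a b c r)))
           (Tri-relabelled (rainbow-rotate b c a (rainbow-rotate a b c r)))
       | code-≼ r
  ... | E , E∈ , q | g , pg , s =
    E , subst (λ k → E ∈ extend k (d ∷ D)) (length-map f (tails a C)) E∈ , g , pg , ↭-trans q s

-- `extend` yields nothing from an empty code. If no word starts with `b`, then none starts with
-- `a`, and all start with `c`.
rest-nonempty : ∀ {n} {a b c} → rainbow a b c ≡ true → (C : List (Word (suc n))) →
  length (tails a C) ≤ length (tails b C) → 1 ≤ length C → 1 ≤ length (tails b C ++ tails c C)
rest-nonempty {a = a} {b} {c} r C a≤b 1≤C =
  subst (1 ≤_) (sym (length-++ (tails b C))) (positive a≤b (subst (1 ≤_) (length-blocks r C) 1≤C))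
  where
  positive : ∀ {k p q} → k ≤ p → 1 ≤ k + (p + q) → 1 ≤ p + q
  positive {p = zero}  z≤n 1≤q = 1≤q
  positive {p = suc p} _   _   = s≤s z≤n

-- Induction on the length: drop the words with the least frequent symbol `a`, represent the
-- punctured rest by `D` via some `f`, and apply the same `f` to the tails of the dropped words. At
-- length 0, three empty words would violate `Tri`.
represented : ∀ n (C : List (Word n)) → Tri C → 1 ≤ length C →
  ∃ λ D → D ∈ representatives n (length C) × D ≼ C
represented zero ([] ∷ [])       t _ = _ , here refl , ≼-refl
represented zero ([] ∷ [] ∷ [])  t _ = _ , here refl , ≼-refl
represented zero ([] ∷ [] ∷ [] ∷ C) t _ with t {[]} {[]} {[]} ↭-refl
... | ()
represented (suc n) C t 1≤C with least-symbol (λ s → length (tails s C))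
... | a , b , c , r , a≤b , a≤c
  with represented n (tails b C ++ tails c C) (Tri-tails (rainbow-rotate a b c r) t)
         (rest-nonempty r C a≤b 1≤C)
... | D , D∈ , f , pf , p
  with extension D (subst (1 ≤_) (sym (trans (↭-length p) (length-map f (tails b C ++ tails c C)))) (rest-nonempty r C a≤b 1≤C))
         (↭-trans p (↭-reflexive (map-++ f (tails b C) (tails c C))))
  where
  extension : ∀ D → 1 ≤ length D → D ↭ map f (tails b C) ++ map f (tails c C) →
    ∃ λ E → E ∈ extend (length (tails a C)) D × E ≼ C
  extension (d ∷ D) _ p with ∈-++⁻ (map f (tails b C)) (∈-resp-↭ p (here refl))
  ... | inj₁ d∈ = extend-≼ t pf r p d∈
  -- Here the first word of `D` comes from the block of `c`, so `b` and `c` trade roles to give it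
  -- the symbol 1.
  ... | inj₂ d∈ = extend-≼ t pf (rainbow-swap₂₃ a b c r) (↭-trans p (++-comm (map f (tails b C)) _)) d∈
...   | E , E∈ , E≼C = normalise E , ∈-reduce found , ≼-trans (normalise-≼ E) E≼C
  where
  remaining : length (tails b C ++ tails c C) ≡ length C ∸ length (tails a C)
  remaining = trans (length-++ (tails b C))
    (sym (trans (cong (_∸ length (tails a C)) (length-blocks r C)) (m+n∸m≡n (length (tails a C)) _)))

  found : E ∈ concatMap (λ k → concatMap (extend k) (representatives n (length C ∸ k))) (upTo (suc (length C / 3)))
  found = ∈-concatMap⁺ _ (lose (∈-upTo⁺ (s≤s (least-third a≤b a≤c (length-blocks r C))))
    (∈-concatMap⁺ _ (lose (subst (λ m → D ∈ representatives n m) remaining D∈) E∈)))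

-- From the search to the numerical bound.

unrepresented : ∀ n m → 1 ≤ m → representatives n m ≡ [] → (C : List (Word n)) → Tri C → length C ≢ m
unrepresented n m 1≤m none C t len with represented n C t (subst (1 ≤_) (sym len) 1≤m)
... | D , D∈ , _ with subst (D ∈_) (trans (cong (representatives n) len) none) D∈
...   | ()

-- The rational bound `r / q` on the size, cleared of its denominator.
Bounded : ℕ → ℕ → ℕ → Set
Bounded n q r = (C : List (Word n)) → Tri C → q * length C ≤ r

abstract
  no-code₆,₁₄ : representatives 6 14 ≡ []
  -- Type checking runs the whole search here; `abstract` keeps later uses from unfolding it.
  no-code₆,₁₄ = refl

-- Any larger code contains one of exactly 14 words, so a single search suffices.
bounded₆ : Bounded 6 1 13
bounded₆ C t = subst (_≤ 13) (sym (*-identityˡ (length C))) (≮⇒≥ λ 14≤C →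
  unrepresented 6 14 (s≤s z≤n) no-code₆,₁₄ (take 14 C) (Tri-++ˡ (Tri-resp-↭ (↭-reflexive (sym (take++drop≡id 14 C))) t))
    (trans (length-take 14 C) (m≤n⇒m⊓n≡m 14≤C)))

-- Each pair of symbols in the first coordinate carries a trifferent code of length n, and
-- every word is counted by two of the three pairs.
bounded-suc : ∀ {n q r} → Bounded n q r → Bounded (suc n) (2 * q) (3 * r)
bounded-suc {n} {q} {r} bound C t = begin
  2 * q * length C                                    ≡⟨ cong (2 * q *_) (length-blocks {a = 0F} {1F} {2F} refl C) ⟩
  2 * q * (# 0F + (# 1F + # 2F))                ≡⟨ regroup q (# 0F) (# 1F) (# 2F) ⟩
  q * (# 0F + # 1F) + (q * (# 1F + # 2F) + (q * (# 2F + # 0F) + 0))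
    ≤⟨ +-mono-≤ (pair 0F 1F 2F refl) (+-mono-≤ (pair 1F 2F 0F refl) (+-mono-≤ (pair 2F 0F 1F refl) z≤n)) ⟩
  3 * r                                               ∎
  where
  open ≤-Reasoning
  # : Fin 3 → ℕ
  # s = length (tails s C)
  regroup : ∀ q x y z → 2 * q * (x + (y + z)) ≡ q * (x + y) + (q * (y + z) + (q * (z + x) + 0))
  regroup = solve-∀
  pair : ∀ a b c → rainbow a b c ≡ true → q * (# a + # b) ≤ r
  pair a b c rb = subst (λ m → q * m ≤ r) (length-++ (tails a C)) (bound _ (Tri-tails rb t))

-- Rounding down at every step is decisive: 13 (3/2)^6 is about 148.1, above the target 1.09
-- (3/2)^12, about 141.4.
bounded-suc-⌊⌋ : ∀ {n m} → Bounded n 1 m → Bounded (suc n) 1 (3 * m / 2)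
bounded-suc-⌊⌋ {m = m} bound C t = begin
  1 * length C       ≡⟨ *-identityˡ (length C) ⟩
  length C           ≡⟨ m*n/n≡m (length C) 2 ⟨
  length C * 2 / 2   ≤⟨ /-monoˡ-≤ 2 (≤-trans (≤-reflexive (*-comm (length C) 2)) (bounded-suc {q = 1} {m} bound C t)) ⟩
  3 * m / 2          ∎
  where open ≤-Reasoning

bounded₁₂ : Bounded 12 1 141
bounded₁₂ = bounded-suc-⌊⌋ (bounded-suc-⌊⌋ (bounded-suc-⌊⌋ (bounded-suc-⌊⌋ (bounded-suc-⌊⌋ (bounded-suc-⌊⌋ bounded₆)))))

bounded-from-12 : ∀ j → Bounded (j + 12) (100 * 2 ^ (j + 12)) (109 * 3 ^ (j + 12))
bounded-from-12 zero C t = ≤-trans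
  (*-monoʳ-≤ (100 * 2 ^ 12) (subst (_≤ 141) (*-identityˡ (length C)) (bounded₁₂ C t)))
  (≤ᵇ⇒≤ (100 * 2 ^ 12 * 141) (109 * 3 ^ 12) _)
bounded-from-12 (suc j) = subst₂ (Bounded (suc j + 12)) (carry 2 100 (2 ^ (j + 12))) (carry 3 109 (3 ^ (j + 12)))
  (bounded-suc {q = 100 * 2 ^ (j + 12)} (bounded-from-12 j))
  where
  carry : ∀ b q p → b * (q * p) ≡ q * (b * p)
  carry = solve-∀

theorem2 : (n : ℕ) → 12 ≤ n → (C : TrifferentCode n) →
    100 * (2 ^ n) * length (TrifferentCode.words C) ≤ 109 * (3 ^ n)
theorem2 n 12≤n C = subst (λ k → Bounded k (100 * 2 ^ k) (109 * 3 ^ k)) (m∸n+n≡m 12≤n)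
  (bounded-from-12 (n ∸ 12)) (TrifferentCode.words C) (code⇒Tri C)
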